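{- Let $G=K_{1,m}$ be a star of order $m+1\geq 4$. Then for every permutation $\alpha$ of the vertex indices, $tpc(P_\alpha(G))=3$.
   Context: All graphs are simple, finite and undirected. For a graph $G$ with $V(G)=\{v_1,\dots,v_n\}$ and a permutation $\alpha$ of $[n]$, let $G'$ be a disjoint copy of $G$ with vertices $u_1,\dots,u_n$, $u_i$ corresponding to $v_i$; the permutation graph $P_\alpha(G)$ is obtained from $G\cup G'$ by adding all edges $v_iu_{\alpha(i)}$, $i\in[n]$. A graph is total-colored if all its vertices and edges are assigned colors. A path in a total-colored graph is a total proper path if (i) any two adjacent edges on the path differ in color, (ii) any two adjacent internal vertices of the path differ in color, and (iii) every internal vertex of the path differs in color from the edges of the path incident with it. A total-colored graph is total-proper connected if any two vertices are joined by a total proper path. For a connected graph $G$, $tpc(G)$ is the smallest number of colors in a total-coloring making $G$ total-proper connected. -}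

module Defs where

open import Data.Nat using (ℕ; suc; _<_)
open import Data.Fin using (Fin; zero)
open import Data.Fin.Permutation using (Permutation′; _⟨$⟩ʳ_)
open import Data.List using (List; []; _∷_; _++_; [_])
open import Data.List.Relation.Unary.Unique.Propositional using (Unique)
open import Data.Product using (Σ; ∃; _×_; _,_)
open import Data.Sum using (_⊎_; inj₁; inj₂)
open import Data.Unit using (⊤)
open import Data.Empty using (⊥)
open import Relation.Nullary using (¬_)
open import Relation.Binary.PropositionalEquality using (_≡_; _≢_)

Graph : Set → Set₁
Graph V = V → V → Set

record TotalColoring (V : Set) (k : ℕ) : Set where
  field
    vc  : V → Fin k
    ec  : V → V → Fin k
    ec-sym : ∀ u v → ec u v ≡ ec v u
open TotalColoring public

module _ {V : Set} (E : Graph V) {k : ℕ} (c : TotalColoring V k) where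

  AdjChain : List V → Set
  AdjChain (x ∷ y ∷ r) = E x y × AdjChain (y ∷ r)
  AdjChain _ = ⊤

  TripleCond : List V → Set
  TripleCond (x ∷ y ∷ z ∷ r) =
    (ec c x y ≢ ec c y z) × (vc c y ≢ ec c x y) × (vc c y ≢ ec c y z)
      × TripleCond (y ∷ z ∷ r)
  TripleCond _ = ⊤

  -- condition (ii): adjacent internal vertices b, c differ in color
  QuadCond : List V → Set
  QuadCond (a ∷ b ∷ d ∷ e ∷ r) = (vc c b ≢ vc c d) × QuadCond (b ∷ d ∷ e ∷ r)
  QuadCond _ = ⊤

  TotalProperPath : List V → Set
  TotalProperPath xs = Unique xs × AdjChain xs × TripleCond xs × QuadCond xs

  TotalProperConnected : Set
  TotalProperConnected =
    ∀ u v → u ≢ v → ∃ λ (mid : List V) → TotalProperPath (u ∷ mid ++ [ v ])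

HasTPC : {V : Set} → Graph V → ℕ → Set
HasTPC {V} E k = Σ (TotalColoring V k) λ c → TotalProperConnected E c

TPCIs : {V : Set} → Graph V → ℕ → Set
TPCIs E k = HasTPC E k × (∀ j → j < k → ¬ HasTPC E j)

-- permutation graph P_α(G) on vertices v_i = inj₁ i, u_i = inj₂ i
PermGraph : {n : ℕ} → Graph (Fin n) → Permutation′ n → Graph (Fin n ⊎ Fin n)
PermGraph E α (inj₁ i) (inj₁ j) = E i j
PermGraph E α (inj₂ i) (inj₂ j) = E i j
PermGraph E α (inj₁ i) (inj₂ j) = (α ⟨$⟩ʳ i) ≡ j
PermGraph E α (inj₂ j) (inj₁ i) = (α ⟨$⟩ʳ i) ≡ j

Star : (m : ℕ) → Graph (Fin (suc m))
Star m i j = (i ≡ zero × j ≢ zero) ⊎ (j ≡ zero × i ≢ zero)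

{-# OPTIONS --safe #-}
-- Below three colours, two leaves of the first star cannot be joined: an inner vertex and its two
-- edges on a total proper path carry three different colours.
--
-- For three colours, let a, b be the two centres.  Pick a matching edge x y with x, y leaves of a, b,
-- which exists because at most two matching edges meet a centre.  Colour the vertices and edges so
-- that every arc of
--   x′ → y′ (matched leaves other than x, y),   y′ → b → y → x → a → x′
-- goes round the colours cyclically: its tail, itself and its head have colours c, c+1, c+2.  Every
-- directed path is then total proper, and so is its reverse; any two vertices lie on a common
-- directed path.
module Submission where

open import Defs
open import Data.Bool using (_∨_; if_then_else_)
open import Data.Bool.Properties using (∨-comm; ∨-zeroʳ)
open import Data.Fin using (Fin; zero; suc)
open import Data.Fin.Patterns using (0F; 1F; 2F)
open import Data.Fin.Permutation using (Permutation′; _⟨$⟩ʳ_; _⟨$⟩ˡ_; inverseˡ; inverseʳ)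
open import Data.Fin.Properties using (_≟_; pigeonhole)
open import Data.List using (List; []; _∷_; _++_; [_]; reverse; _ʳ++_)
open import Data.List.Properties using (reverse-++; unfold-reverse; ++-assoc)
open import Data.List.Membership.Propositional using (_∈_)
open import Data.List.Membership.Propositional.Properties using (∈-∃++; ∈-++⁺ˡ; ∈-++⁺ʳ)
open import Data.List.Relation.Unary.All using ([]; _∷_)
import Data.List.Relation.Unary.All.Properties as Allₚ
open import Data.List.Relation.Unary.AllPairs using (AllPairs; []; _∷_)
import Data.List.Relation.Unary.AllPairs.Properties as AllPairsₚ
open import Data.List.Relation.Unary.Any using (here; there)
open import Data.List.Relation.Unary.Linked using (Linked; []; [-]; _∷_)
open import Data.List.Relation.Unary.Unique.Propositional using (Unique)
import Data.List.Relation.Binary.Permutation.Setoid as ↭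
import Data.List.Relation.Binary.Permutation.Setoid.Properties as ↭ₚ
open import Data.Nat using (ℕ; suc; _≤_; _<_; s≤s; z≤n)
open import Data.Product using (∃; _×_; _,_)
open import Data.Sum using (_⊎_; inj₁; inj₂)
open import Data.Sum.Properties using (inj₁-injective; inj₂-injective)
open import Data.Vec using (lookup; []; _∷_)
open import Data.Unit using (tt)
open import Function using (_∘_; flip)
open import Relation.Nullary using (¬_; yes; no; does; contradiction)
open import Relation.Nullary.Decidable using (dec-true; dec-false)
open import Relation.Binary.PropositionalEquality
  using (_≡_; _≢_; refl; sym; trans; cong; subst; setoid)

-- Directed trails: segments and reversal.

module _ {A : Set} where

  module _ {R : A → A → Set} where

    Linked-++ˡ : ∀ xs {ys} → Linked R (xs ++ ys) → Linked R xs
    Linked-++ˡ []           _        = []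
    Linked-++ˡ (x ∷ [])     _        = [-]
    Linked-++ˡ (x ∷ y ∷ xs) (r ∷ rs) = r ∷ Linked-++ˡ (y ∷ xs) rs

    AllPairs-++ˡ : ∀ xs {ys} → AllPairs R (xs ++ ys) → AllPairs R xs
    AllPairs-++ˡ []       _        = []
    AllPairs-++ˡ (x ∷ xs) (p ∷ ps) = Allₚ.++⁻ˡ xs p ∷ AllPairs-++ˡ xs ps

  -- Reversal with an accumulator: `x` heads both the unread part and the accumulator, which
  -- provides the arc for the next element to be moved.
  Linked-ʳ++ : ∀ {R : A → A → Set} {x} xs {ys} → Linked R (x ∷ xs) → Linked (flip R) (x ∷ ys) →
               Linked (flip R) (xs ʳ++ (x ∷ ys))
  Linked-ʳ++ []       _        q = q
  Linked-ʳ++ (w ∷ xs) (r ∷ rs) q = Linked-ʳ++ xs rs (r ∷ q)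

  Linked-reverse : ∀ {R : A → A → Set} {xs} → Linked R xs → Linked (flip R) (reverse xs)
  Linked-reverse {xs = []}     _ = []
  Linked-reverse {xs = x ∷ xs} p = Linked-ʳ++ xs p [-]

  Unique-reverse : ∀ {xs : List A} → Unique xs → Unique (reverse xs)
  Unique-reverse {xs} = ↭ₚ.Unique-resp-↭ S (↭.↭-sym S (↭ₚ.↭-reverse S xs))
    where S = setoid A

  reverse-∷-∷ʳ : ∀ (u : A) xs v → reverse (u ∷ xs ++ [ v ]) ≡ v ∷ reverse xs ++ [ u ]
  reverse-∷-∷ʳ u xs v = trans (unfold-reverse u (xs ++ [ v ]))
                              (cong (_++ [ u ]) (reverse-++ xs [ v ]))

  Trail : (A → A → Set) → List A → Set
  Trail R xs = Linked R xs × Unique xs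

  Trail-tail : ∀ {R : A → A → Set} {x xs} → Trail R (x ∷ xs) → Trail R xs
  Trail-tail ([-]    , _ ∷ us) = [] , us
  Trail-tail (_ ∷ rs , _ ∷ us) = rs , us

  Trail-segment : ∀ {R : A → A → Set} {u v ys} → Trail R (u ∷ ys) → v ∈ ys →
                  ∃ λ mid → Trail R (u ∷ mid ++ [ v ])
  Trail-segment {R} {u} {v} (rs , us) v∈ys with ∈-∃++ v∈ys
  ... | as , bs , refl = as , Linked-++ˡ (u ∷ as ++ [ v ]) (subst (Linked R) eq rs)
                            , AllPairs-++ˡ (u ∷ as ++ [ v ]) (subst Unique eq us)
    where
    eq : u ∷ as ++ v ∷ bs ≡ (u ∷ as ++ [ v ]) ++ bs
    eq = cong (u ∷_) (sym (++-assoc as [ v ] bs))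

  Trail-reverse : ∀ {R : A → A → Set} {u xs v} → Trail R (u ∷ xs ++ [ v ]) →
                  Trail (flip R) (v ∷ reverse xs ++ [ u ])
  Trail-reverse {R} {u} {xs} {v} (rs , us) =
    subst (Trail (flip R)) (reverse-∷-∷ʳ u xs v) (Linked-reverse rs , Unique-reverse us)

  -- Induction reaches the first of `u` and `v` on the list. If it is `u`, the segment up to `v`
  -- serves; if it is `v`, the segment up to `u` is reversed, which turns every arc round.
  Trail-between : ∀ {R : A → A → Set} {u v xs} → Trail R xs → u ∈ xs → v ∈ xs → u ≢ v →
                  (∃ λ mid → Trail R (u ∷ mid ++ [ v ])) ⊎
                  (∃ λ mid → Trail (flip R) (u ∷ mid ++ [ v ]))
  Trail-between t (here refl) (here refl) u≢v = contradiction refl u≢v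
  Trail-between t (here refl) (there v∈)  u≢v = inj₁ (Trail-segment t v∈)
  Trail-between t (there u∈)  (here refl) u≢v with Trail-segment t u∈
  ... | mid , t′ = inj₂ (reverse mid , Trail-reverse t′)
  Trail-between t (there u∈)  (there v∈)  u≢v = Trail-between (Trail-tail t) u∈ v∈ u≢v

-- The cyclic order of the three colours.

next : Fin 3 → Fin 3
next 0F = 1F
next 1F = 2F
next 2F = 0F

next-≢ : ∀ t → t ≢ next t
next-≢ 0F ()
next-≢ 1F ()
next-≢ 2F ()

next²-≢ : ∀ t → t ≢ next (next t)
next²-≢ 0F ()
next²-≢ 1F ()
next²-≢ 2F ()

-- From locally proper arcs to total proper paths.

module _ {V : Set} {E : Graph V} {k : ℕ} (c : TotalColoring V k) where

  -- The path conditions broken down to single arcs and pairs of consecutive arcs, so that every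
  -- `R`-linked list inherits them.
  record Proper (R : V → V → Set) : Set where
    field
      edge   : ∀ {x y} → R x y → E x y
      ends-≢ : ∀ {x y} → R x y → vc c x ≢ vc c y
      edge-≢ : ∀ {x y z} → R x y → R y z → ec c x y ≢ ec c y z
      head-≢ : ∀ {x y} → R x y → vc c y ≢ ec c x y
      tail-≢ : ∀ {x y} → R x y → vc c x ≢ ec c x y

  module _ {R : V → V → Set} (P : Proper R) where
    open Proper P

    adjChain : ∀ {xs} → Linked R xs → AdjChain E c xs
    adjChain []           = tt
    adjChain [-]          = tt
    adjChain (r ∷ [-])    = edge r , tt
    adjChain (r ∷ s ∷ rs) = edge r , adjChain (s ∷ rs)

    tripleCond : ∀ {xs} → Linked R xs → TripleCond E c xs
    tripleCond []               = tt
    tripleCond [-]              = tt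
    tripleCond (r ∷ [-])        = tt
    tripleCond (r ∷ s ∷ [-])    = edge-≢ r s , head-≢ r , tail-≢ s , tt
    tripleCond (r ∷ s ∷ q ∷ rs) = edge-≢ r s , head-≢ r , tail-≢ s , tripleCond (s ∷ q ∷ rs)

    quadCond : ∀ {xs} → Linked R xs → QuadCond E c xs
    quadCond []                   = tt
    quadCond [-]                  = tt
    quadCond (r ∷ [-])            = tt
    quadCond (r ∷ s ∷ [-])        = tt
    quadCond (r ∷ s ∷ q ∷ [-])    = ends-≢ s , tt
    quadCond (r ∷ s ∷ q ∷ p ∷ rs) = ends-≢ s , quadCond (s ∷ q ∷ p ∷ rs)

    totalProper : ∀ {xs} → Trail R xs → TotalProperPath E c xs
    totalProper (rs , us) = us , adjChain rs , tripleCond rs , quadCond rs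

  -- Reversal exchanges `head-≢` with `tail-≢` and swaps consecutive arcs; `ec-sym` carries the edge
  -- colours over.
  Proper-flip : (∀ x y → E x y → E y x) → ∀ {R} → Proper R → Proper (flip R)
  Proper-flip E-sym P = record
    { edge   = λ r → E-sym _ _ (edge r)
    ; ends-≢ = λ r → ends-≢ r ∘ sym
    ; edge-≢ = λ {x} {y} {z} r s e →
        edge-≢ s r (trans (ec-sym c z y) (trans (sym e) (ec-sym c x y)))
    ; head-≢ = λ {x} {y} r e → tail-≢ r (trans e (ec-sym c x y))
    ; tail-≢ = λ {x} {y} r e → head-≢ r (trans e (ec-sym c x y))
    }
    where open Proper P

  connect : (∀ x y → E x y → E y x) → ∀ {R} → Proper R → ∀ {u v xs} → Trail R xs →
            u ∈ xs → v ∈ xs → u ≢ v → ∃ λ mid → TotalProperPath E c (u ∷ mid ++ [ v ])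
  connect E-sym P t u∈ v∈ u≢v with Trail-between t u∈ v∈ u≢v
  ... | inj₁ (mid , t′) = mid , totalProper P t′
  ... | inj₂ (mid , t′) = mid , totalProper (Proper-flip E-sym P) t′

module _ {V : Set} (E : Graph V) (c : TotalColoring V 3) where

  Arc : V → V → Set
  Arc u v = E u v × ec c u v ≡ next (vc c u) × vc c v ≡ next (ec c u v)

  -- Along consecutive arcs each vertex or edge has the successor of the colour just before it. The
  -- colours compared are thus one or two steps apart, and modulo 3 neither shift has a fixed point.
  Arc-proper : Proper {E = E} c Arc
  Arc-proper = record
    { edge   = λ (e , _) → e
    ; ends-≢ = λ (_ , p , q) h → next²-≢ _ (trans h (trans q (cong next p)))
    ; edge-≢ = λ (_ , _ , q) (_ , p , _) h → next²-≢ _ (trans h (trans p (cong next q)))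
    ; head-≢ = λ (_ , _ , q) h → next-≢ _ (trans (sym h) q)
    ; tail-≢ = λ (_ , p , _) h → next-≢ _ (trans h p)
    }

-- The lower bound.

¬three-distinct : ∀ {j} → j < 3 → {p q r : Fin j} → p ≢ q → p ≢ r → ¬ (q ≢ r)
¬three-distinct j<3 {p} {q} {r} p≢q p≢r q≢r with pigeonhole j<3 (lookup (p ∷ q ∷ r ∷ []))
... | 0F , 1F , _ , e = p≢q e
... | 0F , 2F , _ , e = p≢r e
... | 1F , 2F , _ , e = q≢r e
... | 0F , 0F , () , _
... | 1F , 0F , () , _
... | 1F , 1F , s≤s () , _
... | 2F , 0F , () , _
... | 2F , 1F , s≤s () , _
... | 2F , 2F , s≤s (s≤s ()) , _

≥3-colors : ∀ {V} {E : Graph V} {u v} → u ≢ v → ¬ E u v → ∀ j → j < 3 → ¬ HasTPC E j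
≥3-colors {u = u} {v} u≢v ¬uv j j<3 (c , conn) with conn u v u≢v
... | []        , _ , (uv , _) , _                = ¬uv uv
-- Both remaining cases use the first inner vertex; the split after it lets `TripleCond` compute.
... | _ ∷ []    , _ , _ , (ee , ve , ve′ , _) , _ = ¬three-distinct j<3 ve ve′ ee
... | _ ∷ _ ∷ _ , _ , _ , (ee , ve , ve′ , _) , _ = ¬three-distinct j<3 ve ve′ ee

-- Choosing leaves and colouring one star.

∃-avoiding : ∀ {k} (p q : Fin (suc (suc (suc k)))) → ∃ λ r → r ≢ p × r ≢ q
∃-avoiding p q with 0F ≟ p | 0F ≟ q | 1F ≟ p | 1F ≟ q
... | no 0≢p   | no 0≢q   | _        | _        = 0F , 0≢p , 0≢q
... | _        | _        | no 1≢p   | no 1≢q   = 1F , 1≢p , 1≢q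
... | yes refl | _        | _        | yes refl = 2F , (λ ()) , λ ()
... | _        | yes refl | yes refl | _        = 2F , (λ ()) , λ ()
... | yes refl | _        | yes ()   | _
... | _        | yes refl | _        | yes ()

module _ {m : ℕ} where

  starVc : (s : Fin (suc m)) (special generic : Fin 3) → Fin (suc m) → Fin 3
  starVc s p q i = if does (i ≟ zero) then 2F else if does (i ≟ s) then p else q

  starEc : (s : Fin (suc m)) (special generic : Fin 3) → Fin (suc m) → Fin (suc m) → Fin 3
  starEc s p q i j = if does (i ≟ s) ∨ does (j ≟ s) then p else q

  starEc-sym : ∀ s p q i j → starEc s p q i j ≡ starEc s p q j i
  starEc-sym s p q i j = cong (if_then p else q) (∨-comm (does (i ≟ s)) (does (j ≟ s)))

  module _ {s : Fin (suc m)} (s≢0 : s ≢ zero) {p q : Fin 3} where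

    starVc-special : starVc s p q s ≡ p
    starVc-special rewrite dec-false (s ≟ zero) s≢0 | dec-true (s ≟ s) refl = refl

    starEc-special : starEc s p q zero s ≡ p
    starEc-special rewrite dec-true (s ≟ s) refl | ∨-zeroʳ (does (zero ≟ s)) = refl

    module _ {i : Fin (suc m)} (i≢s : i ≢ s) where

      starVc-generic : i ≢ zero → starVc s p q i ≡ q
      starVc-generic i≢0 rewrite dec-false (i ≟ zero) i≢0 | dec-false (i ≟ s) i≢s = refl

      starEc-generic : starEc s p q zero i ≡ q
      starEc-generic rewrite dec-false (zero ≟ s) (s≢0 ∘ sym) | dec-false (i ≟ s) i≢s = refl

-- The permutation graph of a star: colouring and trails.

PermGraph-sym : ∀ {n} {E : Graph (Fin n)} (α : Permutation′ n) → (∀ i j → E i j → E j i) →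
                ∀ u v → PermGraph E α u v → PermGraph E α v u
PermGraph-sym α E-sym (inj₁ i) (inj₁ j) e = E-sym i j e
PermGraph-sym α E-sym (inj₁ i) (inj₂ j) e = e
PermGraph-sym α E-sym (inj₂ i) (inj₁ j) e = e
PermGraph-sym α E-sym (inj₂ i) (inj₂ j) e = E-sym i j e

Star-sym : ∀ {m} i j → Star m i j → Star m j i
Star-sym _ _ (inj₁ p) = inj₂ p
Star-sym _ _ (inj₂ p) = inj₁ p

module _ {m : ℕ} (α : Permutation′ (suc m)) (s i₀ j₀ : Fin (suc m))
         (s≢0 : s ≢ zero) (αs≢0 : α ⟨$⟩ʳ s ≢ zero)
         (i₀≢0 : i₀ ≢ zero) (i₀≢s : i₀ ≢ s)
         (j₀≢0 : j₀ ≢ zero) (j₀≢αs : j₀ ≢ α ⟨$⟩ʳ s) where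

  private
    V = Fin (suc m) ⊎ Fin (suc m)
    E = PermGraph (Star m) α

    s′ = α ⟨$⟩ʳ s

    a b x y : V
    a = inj₁ zero
    b = inj₂ zero
    x = inj₁ s
    y = inj₂ s′

    α-injective : ∀ {i j} → α ⟨$⟩ʳ i ≡ α ⟨$⟩ʳ j → i ≡ j
    α-injective e = trans (sym (inverseˡ α)) (trans (cong (α ⟨$⟩ˡ_) e) (inverseˡ α))

    Generic₁ Generic₂ : Fin (suc m) → Set
    Generic₁ i = i ≢ zero × i ≢ s
    Generic₂ j = j ≢ zero × j ≢ s′

  -- The closed walk `b → y → x → a → x′ → y′ → b` has six arcs, and each advances the colour by
  -- two, so the cyclic rule closes up modulo 3. Starting with `2F` at `b`, it dictates all colours
  -- on this walk.
  coloring : TotalColoring V 3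
  coloring = record { vc = vc′ ; ec = ec′ ; ec-sym = ec′-sym }
    where
    vc′ : V → Fin 3
    vc′ (inj₁ i) = starVc s  0F 1F i
    vc′ (inj₂ j) = starVc s′ 1F 0F j

    ec′ : V → V → Fin 3
    ec′ (inj₁ i) (inj₁ j) = starEc s  1F 0F i j
    ec′ (inj₂ i) (inj₂ j) = starEc s′ 0F 1F i j
    -- A matching edge at a centre shares the colour `2F` of that centre, so it is never an arc.
    ec′ _        _        = 2F

    ec′-sym : ∀ u v → ec′ u v ≡ ec′ v u
    ec′-sym (inj₁ i) (inj₁ j) = starEc-sym s 1F 0F i j
    ec′-sym (inj₁ _) (inj₂ _) = refl
    ec′-sym (inj₂ _) (inj₁ _) = refl
    ec′-sym (inj₂ i) (inj₂ j) = starEc-sym s′ 0F 1F i j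

  private
    _⇒_ : V → V → Set
    _⇒_ = Arc E coloring

    arc : ∀ u v p → E u v → vc coloring u ≡ p → ec coloring u v ≡ next p →
          vc coloring v ≡ next (next p) → u ⇒ v
    arc _ _ _ e refl q r = e , q , trans r (cong next (sym q))

    b⇒y : b ⇒ y
    b⇒y = arc b y 2F (inj₁ (refl , αs≢0)) refl (starEc-special αs≢0) (starVc-special αs≢0)

    y⇒x : y ⇒ x
    y⇒x = arc y x 1F refl (starVc-special αs≢0) refl (starVc-special s≢0)

    x⇒a : x ⇒ a
    x⇒a = arc x a 0F (inj₂ (refl , s≢0)) (starVc-special s≢0)
              (trans (starEc-sym s 1F 0F s zero) (starEc-special s≢0)) refl

    a⇒leaf : ∀ {i} → Generic₁ i → a ⇒ inj₁ i
    a⇒leaf (i≢0 , i≢s) =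
      arc a (inj₁ _) 2F (inj₁ (refl , i≢0)) refl (starEc-generic s≢0 i≢s)
          (starVc-generic s≢0 i≢s i≢0)

    leaf⇒b : ∀ {j} → Generic₂ j → inj₂ j ⇒ b
    leaf⇒b {j} (j≢0 , j≢s′) =
      arc (inj₂ j) b 0F (inj₂ (refl , j≢0)) (starVc-generic αs≢0 j≢s′ j≢0)
          (trans (starEc-sym s′ 0F 1F j zero) (starEc-generic αs≢0 j≢s′)) refl

    leaf⇒leaf : ∀ {i} → Generic₁ i → Generic₂ (α ⟨$⟩ʳ i) → inj₁ i ⇒ inj₂ (α ⟨$⟩ʳ i)
    leaf⇒leaf (i≢0 , i≢s) (j≢0 , j≢s′) =
      arc (inj₁ _) (inj₂ _) 1F refl (starVc-generic s≢0 i≢s i≢0) refl (starVc-generic αs≢0 j≢s′ j≢0)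

    inj₁-≢ : ∀ {i j : Fin (suc m)} → i ≢ j → _≢_ {A = V} (inj₁ i) (inj₁ j)
    inj₁-≢ i≢j = i≢j ∘ inj₁-injective

    inj₂-≢ : ∀ {i j : Fin (suc m)} → i ≢ j → _≢_ {A = V} (inj₂ i) (inj₂ j)
    inj₂-≢ i≢j = i≢j ∘ inj₂-injective

    -- The two end leaves vary independently, while the four inner vertices are fixed.
    spine : Fin (suc m) → Fin (suc m) → List V
    spine j i = inj₂ j ∷ b ∷ y ∷ x ∷ a ∷ inj₁ i ∷ []

    trail₂₁ : ∀ {j i} → Generic₂ j → Generic₁ i → Trail _⇒_ (spine j i)
    trail₂₁ gj@(j≢0 , j≢s′) gi@(i≢0 , i≢s) =
      leaf⇒b gj ∷ b⇒y ∷ y⇒x ∷ x⇒a ∷ a⇒leaf gi ∷ [-] ,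
      (inj₂-≢ j≢0 ∷ inj₂-≢ j≢s′ ∷ (λ ()) ∷ (λ ()) ∷ (λ ()) ∷ []) ∷
      (inj₂-≢ (αs≢0 ∘ sym) ∷ (λ ()) ∷ (λ ()) ∷ (λ ()) ∷ []) ∷
      ((λ ()) ∷ (λ ()) ∷ (λ ()) ∷ []) ∷
      (inj₁-≢ s≢0 ∷ inj₁-≢ (i≢s ∘ sym) ∷ []) ∷
      (inj₁-≢ (i≢0 ∘ sym) ∷ []) ∷ [] ∷ []

    -- A spine ending at `l` is prolonged backwards along the matching edge of `k`, which joins two
    -- generic leaves of the first star.
    trail₁₁ : ∀ {k l} → Generic₁ k → Generic₂ (α ⟨$⟩ʳ k) → Generic₁ l → k ≢ l →
              Trail _⇒_ (inj₁ k ∷ spine (α ⟨$⟩ʳ k) l)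
    trail₁₁ gk@(k≢0 , k≢s) gαk gl k≢l with trail₂₁ gαk gl
    ... | rs , us = leaf⇒leaf gk gαk ∷ rs ,
      ((λ ()) ∷ (λ ()) ∷ (λ ()) ∷ inj₁-≢ k≢s ∷ inj₁-≢ k≢0 ∷ inj₁-≢ k≢l ∷ []) ∷ us

    -- The mirror case prolongs the spine forwards along the matching edge of `k`.
    trail₂₂ : ∀ {j k} → Generic₂ j → Generic₁ k → Generic₂ (α ⟨$⟩ʳ k) → j ≢ α ⟨$⟩ʳ k →
              Trail _⇒_ (spine j k ++ [ inj₂ (α ⟨$⟩ʳ k) ])
    trail₂₂ gj gk gαk@(αk≢0 , αk≢s′) j≢αk with trail₂₁ gj gk
    ... | _ , us =
      leaf⇒b gj ∷ b⇒y ∷ y⇒x ∷ x⇒a ∷ a⇒leaf gk ∷ leaf⇒leaf gk gαk ∷ [-] ,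
      AllPairsₚ.++⁺ us ([] ∷ [])
        ((inj₂-≢ j≢αk ∷ []) ∷ (inj₂-≢ (αk≢0 ∘ sym) ∷ []) ∷ (inj₂-≢ (αk≢s′ ∘ sym) ∷ []) ∷
         ((λ ()) ∷ []) ∷ ((λ ()) ∷ []) ∷ ((λ ()) ∷ []) ∷ [])

    -- Trails through two given vertices.

    kind₁ : ∀ k → Generic₁ k ⊎ inj₁ k ∈ (x ∷ a ∷ [])
    kind₁ k with k ≟ zero | k ≟ s
    ... | yes refl | _        = inj₂ (there (here refl))
    ... | _        | yes refl = inj₂ (here refl)
    ... | no k≢0   | no k≢s   = inj₁ (k≢0 , k≢s)

    kind₂ : ∀ j → Generic₂ j ⊎ inj₂ j ∈ (b ∷ y ∷ [])
    kind₂ j with j ≟ zero | j ≟ s′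
    ... | yes refl | _        = inj₂ (here refl)
    ... | _        | yes refl = inj₂ (there (here refl))
    ... | no j≢0   | no j≢s′  = inj₁ (j≢0 , j≢s′)

    core₁-∈ : ∀ {u j i} → u ∈ (x ∷ a ∷ []) → u ∈ spine j i
    core₁-∈ u∈ = there (there (there (∈-++⁺ˡ u∈)))

    core₂-∈ : ∀ {u j i} → u ∈ (b ∷ y ∷ []) → u ∈ spine j i
    core₂-∈ u∈ = there (∈-++⁺ˡ u∈)

    last-∈ : ∀ {j i} → inj₁ i ∈ spine j i
    last-∈ = there (there (there (there (there (here refl)))))

    -- The end `i` is found without fixing `j`, so vertices of opposite stars can be placed on one
    -- spine separately.
    spine-∋₁ : ∀ k → ∃ λ i → Generic₁ i × (∀ {j} → inj₁ k ∈ spine j i)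
    spine-∋₁ k with kind₁ k
    ... | inj₁ gk = k  , gk            , last-∈
    ... | inj₂ k∈ = i₀ , (i₀≢0 , i₀≢s) , core₁-∈ k∈

    spine-∋₂ : ∀ l → ∃ λ j → Generic₂ j × (∀ {i} → inj₂ l ∈ spine j i)
    spine-∋₂ l with kind₂ l
    ... | inj₁ gl = l  , gl             , here refl
    ... | inj₂ l∈ = j₀ , (j₀≢0 , j₀≢αs) , core₂-∈ l∈

    join : ∀ {u v xs} → Trail _⇒_ xs → u ∈ xs → v ∈ xs → u ≢ v →
           ∃ λ mid → TotalProperPath E coloring (u ∷ mid ++ [ v ])
    join = connect coloring (PermGraph-sym α Star-sym) (Arc-proper E coloring)

    α-s : ∀ {k} → k ≢ s → α ⟨$⟩ʳ k ≢ s′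
    α-s k≢s = k≢s ∘ α-injective

    preimage : ∀ j → ∃ λ k → α ⟨$⟩ʳ k ≡ j
    preimage j = α ⟨$⟩ˡ j , inverseʳ α

  coloring-connected : TotalProperConnected E coloring
  coloring-connected (inj₁ k) (inj₂ l) u≢v with spine-∋₁ k | spine-∋₂ l
  ... | _ , gi , k∈ | _ , gj , l∈ = join (trail₂₁ gj gi) k∈ l∈ u≢v
  coloring-connected (inj₂ l) (inj₁ k) u≢v with spine-∋₁ k | spine-∋₂ l
  ... | _ , gi , k∈ | _ , gj , l∈ = join (trail₂₁ gj gi) l∈ k∈ u≢v
  coloring-connected (inj₁ k) (inj₁ l) u≢v with kind₁ k | kind₁ l
  ... | inj₂ k∈ | _ = let _ , gi , l∈ = spine-∋₁ l in
    join (trail₂₁ (j₀≢0 , j₀≢αs) gi) (core₁-∈ k∈) l∈ u≢v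
  ... | inj₁ gk | inj₂ l∈ = join (trail₂₁ (j₀≢0 , j₀≢αs) gk) last-∈ (core₁-∈ l∈) u≢v
  -- By injectivity of `α`, at most one of the two leaves is matched to the centre `b`; the trail
  -- starts from one that is not.
  ... | inj₁ gk@(_ , k≢s) | inj₁ gl@(_ , l≢s) with α ⟨$⟩ʳ k ≟ zero
  ...   | no αk≢0  =
    join (trail₁₁ gk (αk≢0 , α-s k≢s) gl (u≢v ∘ cong inj₁)) (here refl) (there last-∈) u≢v
  ...   | yes αk≡0 =
    join (trail₁₁ gl (αl≢0 , α-s l≢s) gk (u≢v ∘ cong inj₁ ∘ sym)) (there last-∈) (here refl) u≢v
    where
    αl≢0 : α ⟨$⟩ʳ l ≢ zero
    αl≢0 αl≡0 = u≢v (cong inj₁ (α-injective (trans αk≡0 (sym αl≡0))))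
  coloring-connected (inj₂ h) (inj₂ l) u≢v with kind₂ h | kind₂ l
  ... | inj₂ h∈ | _ = let _ , gj , l∈ = spine-∋₂ l in
    join (trail₂₁ gj (i₀≢0 , i₀≢s)) (core₂-∈ h∈) l∈ u≢v
  ... | inj₁ gh | inj₂ l∈ = join (trail₂₁ gh (i₀≢0 , i₀≢s)) (here refl) (core₂-∈ l∈) u≢v
  ... | inj₁ gh@(_ , h≢s′) | inj₁ gl@(_ , l≢s′) with preimage h | preimage l
  -- The trail enters its final leaf through the preimage of that leaf, which must not be the centre
  -- `a`. At most one of `p` and `q` is, so one of the two leaves can come last.
  ...   | p , refl | q , refl with q ≟ zero
  ...     | no q≢0   =
    join (trail₂₂ gh (q≢0 , l≢s′ ∘ cong (α ⟨$⟩ʳ_)) gl (u≢v ∘ cong inj₂))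
         (here refl) (∈-++⁺ʳ (spine h q) (here refl)) u≢v
  ...     | yes refl =
    join (trail₂₂ gl (p≢0 , h≢s′ ∘ cong (α ⟨$⟩ʳ_)) gh (u≢v ∘ cong inj₂ ∘ sym))
         (∈-++⁺ʳ (spine l p) (here refl)) (here refl) u≢v
    where
    p≢0 : p ≢ zero
    p≢0 refl = u≢v refl

theorem4p2 : (m : ℕ) → 4 ≤ suc m → (α : Permutation′ (suc m)) →
    TPCIs (PermGraph (Star m) α) 3
theorem4p2 (suc (suc (suc k))) (s≤s (s≤s (s≤s (s≤s z≤n)))) α =
  -- Avoiding the centre and its preimage makes both ends of the matching edge leaves.
  let s  , s≢0  , s≢α⁻¹0 = ∃-avoiding zero (α ⟨$⟩ˡ zero)
      -- `i₀` and `j₀` are default ends of spines when a given vertex is already an inner one.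
      i₀ , i₀≢0 , i₀≢s   = ∃-avoiding zero s
      j₀ , j₀≢0 , j₀≢αs  = ∃-avoiding zero (α ⟨$⟩ʳ s)
      αs≢0 = λ αs≡0 → s≢α⁻¹0 (trans (sym (inverseˡ α)) (cong (α ⟨$⟩ˡ_) αs≡0))
  in ( coloring α s i₀ j₀ s≢0 αs≢0 i₀≢0 i₀≢s j₀≢0 j₀≢αs
     , coloring-connected α s i₀ j₀ s≢0 αs≢0 i₀≢0 i₀≢s j₀≢0 j₀≢αs )
   , ≥3-colors {u = inj₁ 1F} {v = inj₁ 2F} (λ ()) (λ { (inj₁ (() , _)) ; (inj₂ (() , _)) })
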